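{- Let $X$ be a finite set. The Möbius function of the poset $\operatorname{Bip}(X)$, evaluated at its minimum and maximum element, is given by $$\mu(\emptyset,X\times X)=(-1)^{|X|}.$$
   Context: A relation $U\subseteq X\times X$ on a finite set $X$ is bipartitional if both $U$ and $(X\times X)\setminus U$ are transitive. $\operatorname{Bip}(X)$ is the set of bipartitional relations on $X$, partially ordered by inclusion; its minimum is $\emptyset$ and its maximum is $X\times X$. $\mu$ denotes the Möbius function of $\operatorname{Bip}(X)$. -}

module Defs where

open import Data.Empty using (⊥)
open import Data.Fin.Base using (Fin; zero; suc; combine; remQuot; finToFun; funToFin)
import Data.Fin.Properties as Fin
import Data.Integer.Properties as ℤ
open import Data.Integer.Base using (ℤ; 0ℤ; 1ℤ; _+_; -_)
open import Data.List.Base using (List; []; _∷_; length; filter; map; mapMaybe; foldr; allFin; deduplicate)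
open import Data.List.Membership.Propositional using (lose)
open import Data.List.Membership.Propositional.Properties using (∈-allFin)
open import Data.List.Relation.Unary.Any as Any using (Any; here; there)
open import Data.List.Relation.Unary.Any.Properties using (map⁺; mapMaybe⁺)
open import Data.List.Relation.Unary.Enumerates.Setoid using (IsEnumeration)
open import Data.List.Relation.Unary.Enumerates.Setoid.Properties using (deduplicate⁺)
open import Data.List.Relation.Unary.Unique.Setoid using (Unique)
open import Data.List.Relation.Unary.Unique.DecSetoid.Properties using (deduplicate-!)
open import Data.Maybe.Base as Maybe using (Maybe)
import Data.Maybe.Relation.Unary.Any as MAny
open import Data.Nat.Base as ℕ using (ℕ; s≤s)
open import Data.Nat.Induction using (<-wellFounded)
import Data.Nat.Properties as ℕ
open import Data.Product.Base using (_×_; _,_)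
open import Data.Unit.Base using (⊤; tt)
open import Function.Base using (_∘_; id)
open import Function.Bundles using (_↔_; Inverse)
open import Induction.WellFounded using (WellFounded; Acc; acc; module Subrelation)
open import Level using (Level; 0ℓ; _⊔_) renaming (suc to lsuc)
open import Relation.Binary.Bundles using (DecPoset)
open import Relation.Binary.Construct.Interior.Symmetric using () renaming (decPoset to symInteriorDecPoset; _,_ to _⇔,_)
import Relation.Binary.Construct.NonStrictToStrict as ToStrict
import Relation.Binary.Construct.On as On
open import Relation.Binary.Core using (Rel; _⇒_)
open import Relation.Binary.Definitions using (Transitive; Decidable)
open import Relation.Binary.PropositionalEquality using (_≡_; refl; sym; trans; cong; cong₂; subst)
open import Relation.Nullary using (¬_; Dec; yes; no; contradiction)
open import Relation.Nullary.Decidable using (map′; ¬?; _×-dec_; _→-dec_; dec⇒maybe)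
import Relation.Unary as U

private
  variable
    a p q : Level

record FinitePoset c ℓ₁ ℓ₂ : Set (lsuc (c ⊔ ℓ₁ ⊔ ℓ₂)) where
  field
    decPoset : DecPoset c ℓ₁ ℓ₂

  open DecPoset decPoset public

  field
    elements : List Carrier
    complete : IsEnumeration Eq.setoid elements
    unique   : Unique Eq.setoid elements

  open ToStrict _≈_ _≤_ public using (_<_)

  _<?_ : Decidable _<_
  _<?_ = ToStrict.<-decidable _≈_ _≤_ _≟_ _≤?_

module _ {A : Set a} {P : U.Pred A p} {Q : U.Pred A q}
         (P? : U.Decidable P) (Q? : U.Decidable Q) (P⊆Q : P U.⊆ Q) where

  filter-mono-≤ : ∀ xs → length (filter P? xs) ℕ.≤ length (filter Q? xs)
  filter-mono-≤ []       = ℕ.z≤n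
  filter-mono-≤ (x ∷ xs) with P? x | Q? x
  ... | yes _  | yes _  = s≤s (filter-mono-≤ xs)
  ... | yes px | no ¬qx = contradiction (P⊆Q px) ¬qx
  ... | no _   | yes _  = ℕ.m≤n⇒m≤1+n (filter-mono-≤ xs)
  ... | no _   | no _   = filter-mono-≤ xs

  filter-mono-< : ∀ {xs} → Any (λ x → Q x × ¬ P x) xs →
                  length (filter P? xs) ℕ.< length (filter Q? xs)
  filter-mono-< {x ∷ xs} (here (qx , ¬px)) with P? x | Q? x
  ... | yes px | _      = contradiction px ¬px
  ... | no _   | yes _  = s≤s (filter-mono-≤ xs)
  ... | no _   | no ¬qx = contradiction qx ¬qx
  filter-mono-< {x ∷ xs} (there any) with P? x | Q? x
  ... | yes _  | yes _  = s≤s (filter-mono-< any)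
  ... | yes px | no ¬qx = contradiction (P⊆Q px) ¬qx
  ... | no _   | yes _  = ℕ.m≤n⇒m≤1+n (filter-mono-< any)
  ... | no _   | no _   = filter-mono-< any

-- ∑ P? f xs is the sum of f z over those entries z of xs that satisfy P;
-- f may use the proof of P z, as the recursion defining μ requires.
module _ {A : Set a} {P : U.Pred A p} (P? : U.Decidable P) where

  summand : (∀ z → P z → ℤ) → ∀ z → Dec (P z) → ℤ
  summand f z (yes pz) = f z pz
  summand f z (no _)   = 0ℤ

  ∑ : (∀ z → P z → ℤ) → List A → ℤ
  ∑ f = foldr (λ z s → summand f z (P? z) + s) 0ℤ

sumℤ : List ℤ → ℤ
sumℤ = foldr _+_ 0ℤ

module _ {A : Set a} {P : U.Pred A p} (P? : U.Decidable P) where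

  ∑-filter : ∀ {f : ∀ z → P z → ℤ} {g : A → ℤ} → (∀ z pz → f z pz ≡ g z) →
             ∀ xs → ∑ P? f xs ≡ sumℤ (map g (filter P? xs))
  ∑-filter f≗g []       = refl
  ∑-filter f≗g (x ∷ xs) with P? x
  ... | yes px = cong₂ _+_ (f≗g x px) (∑-filter f≗g xs)
  ... | no  _  = trans (cong (0ℤ +_) (∑-filter f≗g xs)) (ℤ.+-identityˡ _)

  ∑-cong : ∀ {f g : ∀ z → P z → ℤ} → (∀ z pz → f z pz ≡ g z pz) →
           ∀ xs → ∑ P? f xs ≡ ∑ P? g xs
  ∑-cong f≗g []       = refl
  ∑-cong f≗g (x ∷ xs) with P? x
  ... | yes px = cong₂ _+_ (f≗g x px) (∑-cong f≗g xs)
  ... | no  _  = cong (0ℤ +_) (∑-cong f≗g xs)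

module Möbius {c ℓ₁ ℓ₂} (P : FinitePoset c ℓ₁ ℓ₂) where

  open FinitePoset P renaming (refl to ≤-refl; trans to ≤-trans)

  rank : Carrier → ℕ
  rank y = length (filter (_≤? y) elements)

  rank-mono-< : ∀ {z y} → z < y → rank z ℕ.< rank y
  rank-mono-< {z} {y} (z≤y , z≉y) =
    filter-mono-< (_≤? z) (_≤? y) (λ x≤z → ≤-trans x≤z z≤y)
      (Any.map (λ y≈x → reflexive (Eq.sym y≈x)
                      , λ x≤z → z≉y (antisym z≤y (≤-trans (reflexive y≈x) x≤z)))
               (complete y))

  <-wf : WellFounded _<_
  <-wf = Subrelation.wellFounded rank-mono-< (On.wellFounded rank <-wellFounded)

  _∈[_,_⟩ : Carrier → Carrier → Carrier → Set (ℓ₁ ⊔ ℓ₂)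
  z ∈[ x , y ⟩ = x ≤ z × z < y

  _∈[_,_⟩? : ∀ z x y → Dec (z ∈[ x , y ⟩)
  z ∈[ x , y ⟩? = (x ≤? z) ×-dec (z <? y)

  -- μ x y is 0 when x ≰ y, the sum being empty then.
  μ-acc : ∀ x y → Acc _<_ y → ℤ
  μ-acc x y (acc rec) with x ≟ y
  ... | yes _ = 1ℤ
  ... | no  _ = - ∑ (_∈[ x , y ⟩?) (λ z (_ , z<y) → μ-acc x z (rec z<y)) elements

  μ : Carrier → Carrier → ℤ
  μ x y = μ-acc x y (<-wf y)

  μ-acc-irrelevant : ∀ x y (r s : Acc _<_ y) → μ-acc x y r ≡ μ-acc x y s
  μ-acc-irrelevant x y (acc r) (acc s) with x ≟ y
  ... | yes _ = refl
  ... | no  _ = cong -_ (∑-cong (_∈[ x , y ⟩?)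
                  (λ z (_ , z<y) → μ-acc-irrelevant x z (r z<y) (s z<y)) elements)

  μ-acc-diagonal : ∀ {x y} → x ≈ y → (r : Acc _<_ y) → μ-acc x y r ≡ 1ℤ
  μ-acc-diagonal {x} {y} x≈y (acc _) with x ≟ y
  ... | yes _  = refl
  ... | no x≉y = contradiction x≈y x≉y

  μ-acc-recursion : ∀ {x y} → ¬ x ≈ y → (r : Acc _<_ y) (wf : WellFounded _<_) →
    μ-acc x y r ≡
      - sumℤ (map (λ z → μ-acc x z (wf z)) (filter (_∈[ x , y ⟩?) elements))
  μ-acc-recursion {x} {y} x≉y (acc r) wf with x ≟ y
  ... | yes x≈y = contradiction x≈y x≉y
  ... | no _    = cong -_ (∑-filter (_∈[ x , y ⟩?)
                    (λ z (_ , z<y) → μ-acc-irrelevant x z (r z<y) (wf z)) elements)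

  -- The usual characterisation of the Möbius function:
  -- μ(x,x) = 1 and μ(x,y) = - Σ_{x ≤ z < y} μ(x,z).
  μ-diagonal : ∀ {x y} → x ≈ y → μ x y ≡ 1ℤ
  μ-diagonal x≈y = μ-acc-diagonal x≈y (<-wf _)

  μ-recursion : ∀ {x y} → ¬ x ≈ y →
                μ x y ≡ - sumℤ (map (μ x) (filter (_∈[ x , y ⟩?) elements))
  μ-recursion x≉y = μ-acc-recursion x≉y (<-wf _) <-wf

Bipartitional : ∀ {X : Set a} → Rel X 0ℓ → Set a
Bipartitional U = Transitive U × Transitive (λ x y → ¬ U x y)

-- A subset of X × X with X finite is a decidable relation.  Equality in the
-- poset bipDecPoset below is mutual inclusion.
record Bip (X : Set a) : Set (a ⊔ lsuc 0ℓ) where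
  field
    rel           : Rel X 0ℓ
    rel?          : Decidable rel
    bipartitional : Bipartitional rel

open Bip

infix 4 _⊆_
_⊆_ : ∀ {X : Set a} → Rel (Bip X) a
U ⊆ V = rel U ⇒ rel V

∅ : ∀ {X : Set a} → Bip X
∅ = record
  { rel           = λ _ _ → ⊥
  ; rel?          = λ _ _ → no id
  ; bipartitional = (λ ()) , (λ _ _ → id)
  }

X×X : ∀ (X : Set a) → Bip X
X×X X = record
  { rel           = λ _ _ → ⊤
  ; rel?          = λ _ _ → yes tt
  ; bipartitional = (λ _ _ → tt) , (λ ¬⊤ _ → ¬⊤)
  }

∅-minimum : ∀ {X : Set a} (U : Bip X) → ∅ ⊆ U
∅-minimum U ()

X×X-maximum : ∀ {X : Set a} (U : Bip X) → U ⊆ X×X X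
X×X-maximum U _ = tt

module _ {X : Set a} {n : ℕ} (X↔Fin : X ↔ Fin n) where

  open Inverse X↔Fin using (to; from; strictlyInverseʳ)

  all? : ∀ {P : U.Pred X p} → U.Decidable P → Dec (∀ {x} → P x)
  all? {P = P} P? = map′ (λ h {x} → subst P (strictlyInverseʳ x) (h (to x)))
                         (λ h i → h)
                         (Fin.all? (P? ∘ from))

  _⊆?_ : Decidable (_⊆_ {X = X})
  U ⊆? V = all? λ x → all? λ y → rel? U x y →-dec rel? V x y

  transitive? : ∀ {R : Rel X 0ℓ} → Decidable R → Dec (Transitive R)
  transitive? R? = all? λ x → all? λ y → all? λ z →
                   R? x y →-dec R? y z →-dec R? x z

  bipartitional? : ∀ {R : Rel X 0ℓ} → Decidable R → Dec (Bipartitional R)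
  bipartitional? R? = transitive? R? ×-dec transitive? (λ x y → ¬? (R? x y))

  bipDecPoset : DecPoset (a ⊔ lsuc 0ℓ) a a
  bipDecPoset = symInteriorDecPoset {R = _⊆_ {X = X}} id (λ U⊆V V⊆W → V⊆W ∘ U⊆V) _⊆?_

  open DecPoset bipDecPoset using (_≈_; _≟_; module Eq)

  -- The numbers below 2 ^ (n * n), written in binary, encode the relations on X.
  codes : List (Fin (2 ℕ.^ (n ℕ.* n)))
  codes = allFin _

  Decode : Fin (2 ℕ.^ (n ℕ.* n)) → Rel X 0ℓ
  Decode k x y = finToFun k (combine (to x) (to y)) ≡ suc zero

  Decode? : ∀ k → Decidable (Decode k)
  Decode? k x y = finToFun k (combine (to x) (to y)) Fin.≟ suc zero

  toBip : ∀ k → Bipartitional (Decode k) → Bip X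
  toBip k b = record { rel = Decode k ; rel? = Decode? k ; bipartitional = b }

  fromCode : Fin (2 ℕ.^ (n ℕ.* n)) → Maybe (Bip X)
  fromCode k = Maybe.map (toBip k) (dec⇒maybe (bipartitional? (Decode? k)))

  candidates : List (Bip X)
  candidates = mapMaybe fromCode codes

  bit : ∀ {A : Set} → Dec A → Fin 2
  bit (yes _) = suc zero
  bit (no _)  = zero

  bit⁺ : ∀ {A : Set} (A? : Dec A) → A → bit A? ≡ suc zero
  bit⁺ (yes _) _ = refl
  bit⁺ (no ¬a) a = contradiction a ¬a

  bit⁻ : ∀ {A : Set} (A? : Dec A) → bit A? ≡ suc zero → A
  bit⁻ (yes a) _ = a

  module _ (U : Bip X) where

    at : Fin n × Fin n → Fin 2
    at (i , j) = bit (rel? U (from i) (from j))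

    entry : Fin (n ℕ.* n) → Fin 2
    entry = at ∘ remQuot n

    code : Fin (2 ℕ.^ (n ℕ.* n))
    code = funToFin entry

    code-spec : ∀ x y → finToFun code (combine (to x) (to y)) ≡ bit (rel? U x y)
    code-spec x y =
      trans (Fin.finToFun-funToFin entry (combine (to x) (to y)))
        (trans (cong at (Fin.remQuot-combine (to x) (to y)))
          (cong₂ (λ u v → bit (rel? U u v)) (strictlyInverseʳ x) (strictlyInverseʳ y)))

    code⁺ : rel U ⇒ Decode code
    code⁺ {x} {y} u = trans (code-spec x y) (bit⁺ (rel? U x y) u)

    code⁻ : Decode code ⇒ rel U
    code⁻ {x} {y} d = bit⁻ (rel? U x y) (trans (sym (code-spec x y)) d)

    code-bipartitional : Bipartitional (Decode code)
    code-bipartitional =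
      let (t , t′) = bipartitional U in
      (λ xy yz → code⁺ (t (code⁻ xy) (code⁻ yz))) ,
      (λ xy yz → t′ (xy ∘ code⁺) (yz ∘ code⁺) ∘ code⁻)

    fromCode-code : MAny.Any (U ≈_) (fromCode code)
    fromCode-code with bipartitional? (Decode? code)
    ... | yes _ = MAny.just (code⁺ ⇔, code⁻)
    ... | no ¬b = contradiction code-bipartitional ¬b

    ∈-candidates : Any (U ≈_) candidates
    ∈-candidates = mapMaybe⁺ fromCode codes (map⁺ (lose (∈-allFin code) fromCode-code))

  bipFinitePoset : FinitePoset (a ⊔ lsuc 0ℓ) a a
  bipFinitePoset = record
    { decPoset = bipDecPoset
    ; elements = deduplicate _≟_ candidates
    ; complete = deduplicate⁺ Eq.decSetoid ∈-candidates
    ; unique   = deduplicate-! Eq.decSetoid candidates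
    }

{-# OPTIONS --safe #-}

-- Write μ(V) for μ(∅,V).  If U contains the cut C × Cᶜ and is disjoint from
-- Cᶜ × C, then V ↦ V ∪ (C × Cᶜ) is the join with the cut on [∅,U], and Weisner's
-- theorem says that μ sums to zero over the V with V ∪ (C × Cᶜ) = U.  If
-- U ≠ X × X is not irreflexive, a boundary of a reflexive block provides such
-- a C, and μ(U) = 0 by induction; hence μ(X × X) = - Σ μ(V) over irreflexive V.
-- Let Lᵢ have the blocks {0}, …, {i-1}, {i, …, n-1}.  The irreflexive V ⊇ Lᵢ
-- with V ⊉ Lᵢ₊₁ are grouped by V ∪ (C × Cᶜ), where C consists of the points
-- other than i that are not above i in V; each group sums to zero.  So the sum
-- reduces to μ(Lₙ₋₁), and Weisner's theorem gives μ(Lᵢ₊₁) = - μ(Lᵢ).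

module Submission where

open import Defs
open import Algebra.Properties.AbelianGroup using (inverseʳ-unique)
open import Algebra.Properties.CommutativeSemigroup using (interchange)
open import Data.Empty using (⊥-elim)
open import Data.Fin.Base using (Fin; toℕ; fromℕ<)
import Data.Fin.Properties as Fin
open import Data.Integer.Base using (ℤ; 0ℤ; 1ℤ; -1ℤ; _+_; -_; _^_)
import Data.Integer.Properties as ℤ
open import Data.List.Base using (List; []; _∷_; filter; map)
open import Data.List.Properties using (map-cong)
open import Data.List.Relation.Unary.All as All using (All)
open import Data.List.Relation.Unary.AllPairs using (AllPairs; []; _∷_)
open import Data.List.Relation.Unary.Any using (Any; here; there)
open import Data.Nat.Base as ℕ using (ℕ; zero; suc; s≤s)
import Data.Nat.Properties as ℕ
open import Data.Product.Base using (_×_; _,_; proj₁; proj₂; ∃)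
open import Data.Sum.Base as Sum using (_⊎_; inj₁; inj₂)
open import Function.Base using (_∘_; id; case_of_)
open import Function.Bundles using (_↔_; Inverse; Injection)
open import Function.Properties.Inverse using (↔⇒↣)
open import Induction.WellFounded using (Acc; acc)
open import Level using (Level; 0ℓ)
open import Relation.Binary.Construct.Interior.Symmetric using () renaming (_,_ to _⇔,_)
open import Relation.Binary.Core using (Rel; _⇒_)
open import Relation.Binary.Definitions
  using (Decidable; Minimum; _Respects_; tri<; tri≈; tri>)
open import Relation.Binary.PropositionalEquality
  using (_≡_; _≢_; refl; sym; trans; cong; cong₂; subst; module ≡-Reasoning)
open import Relation.Nullary using (¬_; Dec; yes; no; contradiction)
open import Relation.Nullary.Decidable using (¬?; _×-dec_; _⊎-dec_; _→-dec_; decidable-stable)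
import Relation.Unary as U

open Bip

-- Iverson brackets and integer sums over lists.

private
  variable
    a b q r : Level

-- The Iverson bracket. It turns a sum over a decidable subset into a sum over the whole list, where
-- splitting and exchanging sums work termwise.
⟦_⟧_ : {A : Set a} → Dec A → ℤ → ℤ
⟦ yes _ ⟧ i = i
⟦ no  _ ⟧ i = 0ℤ

⟦⟧-yes : {A : Set a} (A? : Dec A) → A → ∀ i → ⟦ A? ⟧ i ≡ i
⟦⟧-yes (yes _) _ i = refl
⟦⟧-yes (no ¬a) a i = contradiction a ¬a

⟦⟧-zero : {A : Set a} (A? : Dec A) {i : ℤ} → (A → i ≡ 0ℤ) → ⟦ A? ⟧ i ≡ 0ℤ
⟦⟧-zero (yes a) i≡0 = i≡0 a
⟦⟧-zero (no _)  _   = refl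

⟦⟧-⇔ : {A : Set a} {B : Set b} (A? : Dec A) (B? : Dec B) → (A → B) → (B → A) →
       ∀ i → ⟦ A? ⟧ i ≡ ⟦ B? ⟧ i
⟦⟧-⇔ (yes _) (yes _) f g i = refl
⟦⟧-⇔ (yes a) (no ¬b) f g i = contradiction (f a) ¬b
⟦⟧-⇔ (no ¬a) (yes b) f g i = contradiction (g b) ¬a
⟦⟧-⇔ (no _)  (no _)  f g i = refl

⟦⟧-split : {A : Set a} {B : Set b} (A? : Dec A) (B? : Dec B) → ∀ i →
           ⟦ A? ⟧ i ≡ ⟦ A? ×-dec B? ⟧ i + ⟦ A? ×-dec ¬? B? ⟧ i
⟦⟧-split (yes _) (yes _) i = sym (ℤ.+-identityʳ i)
⟦⟧-split (yes _) (no _)  i = sym (ℤ.+-identityˡ i)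
⟦⟧-split (no _)  (yes _) i = refl
⟦⟧-split (no _)  (no _)  i = refl

sumℤ-zero : {A : Set a} {f : A → ℤ} {xs : List A} → All (λ x → f x ≡ 0ℤ) xs →
            sumℤ (map f xs) ≡ 0ℤ
sumℤ-zero All.[]           = refl
sumℤ-zero (fx≡0 All.∷ f≡0) = cong₂ _+_ fx≡0 (sumℤ-zero f≡0)

sumℤ-+ : {A : Set a} (f g : A → ℤ) (xs : List A) →
         sumℤ (map (λ x → f x + g x) xs) ≡ sumℤ (map f xs) + sumℤ (map g xs)
sumℤ-+ f g []       = refl
sumℤ-+ f g (x ∷ xs) = trans (cong (f x + g x +_) (sumℤ-+ f g xs))
  (interchange ℤ.+-commutativeSemigroup (f x) (g x) _ _)

module _ {A : Set a} where

  sumℤ-swap : {B : Set b} (f : A → B → ℤ) (xs : List A) (ys : List B) →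
              sumℤ (map (λ x → sumℤ (map (f x) ys)) xs) ≡
              sumℤ (map (λ y → sumℤ (map (λ x → f x y) xs)) ys)
  sumℤ-swap f []       ys = sym (sumℤ-zero (All.universal (λ _ → refl) ys))
  sumℤ-swap f (x ∷ xs) ys = trans (cong (sumℤ (map (f x) ys) +_) (sumℤ-swap f xs ys))
    (sym (sumℤ-+ (f x) _ ys))

  sumℤ-filter : {P : U.Pred A b} (P? : U.Decidable P) (f : A → ℤ) (xs : List A) →
                sumℤ (map f (filter P? xs)) ≡ sumℤ (map (λ x → ⟦ P? x ⟧ (f x)) xs)
  sumℤ-filter P? f []       = refl
  sumℤ-filter P? f (x ∷ xs) with P? x
  ... | yes _ = cong (f x +_) (sumℤ-filter P? f xs)
  ... | no  _ = trans (sumℤ-filter P? f xs) (sym (ℤ.+-identityˡ _))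

-- Sums over a finite poset.

module Summation {c ℓ₁ ℓ₂} (P : FinitePoset c ℓ₁ ℓ₂) where

  open FinitePoset P using (Carrier; _≈_; _≟_; module Eq; elements; complete; unique)

  Σ : (Carrier → ℤ) → ℤ
  Σ f = sumℤ (map f elements)

  Σ-cong : ∀ {f g} → (∀ x → f x ≡ g x) → Σ f ≡ Σ g
  Σ-cong f≗g = cong sumℤ (map-cong f≗g elements)

  Σ-zero : ∀ {f} → (∀ x → f x ≡ 0ℤ) → Σ f ≡ 0ℤ
  Σ-zero f≡0 = sumℤ-zero (All.universal f≡0 elements)

  -- `elements` is complete and free of repetitions up to `_≈_`, so exactly one entry is equivalent
  -- to `w`, though it need not be `w` itself.
  Σ-single : ∀ {f w i} → (∀ x → w ≈ x → f x ≡ i) → (∀ x → ¬ w ≈ x → f x ≡ 0ℤ) → Σ f ≡ i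
  Σ-single {f} {w} {i} f≡i f≡0 = go unique (complete w)
    where
    go : ∀ {xs} → AllPairs (λ x y → ¬ x ≈ y) xs → Any (w ≈_) xs → sumℤ (map f xs) ≡ i
    go {x ∷ xs} (x≉xs ∷ _) (here w≈x) = trans
      (cong₂ _+_ (f≡i x w≈x)
        (sumℤ-zero (All.map (λ x≉y → f≡0 _ (x≉y ∘ Eq.trans (Eq.sym w≈x))) x≉xs)))
      (ℤ.+-identityʳ i)
    go {x ∷ xs} (x≉xs ∷ xs!) (there w∈xs) = trans
      (cong₂ _+_ (f≡0 x λ w≈x → head≉ x≉xs w≈x w∈xs) (go xs! w∈xs))
      (ℤ.+-identityˡ i)
      where
      head≉ : ∀ {ys} → All (λ y → ¬ x ≈ y) ys → w ≈ x → ¬ Any (w ≈_) ys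
      head≉ (x≉y All.∷ _) w≈x (here w≈y)  = x≉y (Eq.trans (Eq.sym w≈x) w≈y)
      head≉ (_ All.∷ x≉)  w≈x (there w∈) = head≉ x≉ w≈x w∈

  ∑[_] : {Q : U.Pred Carrier q} → U.Decidable Q → (Carrier → ℤ) → ℤ
  ∑[ Q? ] g = Σ (λ x → ⟦ Q? x ⟧ (g x))

  module _ {Q : U.Pred Carrier q} (Q? : U.Decidable Q) (g : Carrier → ℤ) where

    ∑-zero : (∀ x → Q x → g x ≡ 0ℤ) → ∑[ Q? ] g ≡ 0ℤ
    ∑-zero g≡0 = Σ-zero λ x → ⟦⟧-zero (Q? x) (g≡0 x)

    ∑-⇔ : {R : U.Pred Carrier r} (R? : U.Decidable R) →
           (∀ {x} → Q x → R x) → (∀ {x} → R x → Q x) → ∑[ Q? ] g ≡ ∑[ R? ] g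
    ∑-⇔ R? Q⊆R R⊆Q = Σ-cong λ x → ⟦⟧-⇔ (Q? x) (R? x) Q⊆R R⊆Q (g x)

    ∑-split : {R : U.Pred Carrier r} (R? : U.Decidable R) →
              ∑[ Q? ] g ≡ ∑[ (λ x → Q? x ×-dec R? x) ] g + ∑[ (λ x → Q? x ×-dec ¬? (R? x)) ] g
    ∑-split R? = trans (Σ-cong λ x → ⟦⟧-split (Q? x) (R? x) (g x)) (sumℤ-+ _ _ elements)

    ∑-single : (∀ {x y} → x ≈ y → g x ≡ g y) → ∀ {w} → (∀ {x} → w ≈ x → Q x) →
               (∀ x → Q x → ¬ w ≈ x → g x ≡ 0ℤ) → ∑[ Q? ] g ≡ g w
    ∑-single g-cong Qw g≡0 = Σ-single
      (λ x w≈x → trans (⟦⟧-yes (Q? x) (Qw w≈x) (g x)) (g-cong (Eq.sym w≈x)))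
      (λ x w≉x → ⟦⟧-zero (Q? x) λ Qx → g≡0 x Qx w≉x)

    -- On `Q`, `R` is the graph of a function up to `_≈_`, so exchanging two sums regroups the sum
    -- by the value of that function.
    ∑-fibres : {R : Rel Carrier r} (R? : Decidable R) →
               (∀ {x} → Q x → ∃ (R x)) →
               (∀ {x y z} → Q x → R x y → R x z → y ≈ z) →
               (∀ {x} → R x Respects _≈_) →
               (∀ y → ∑[ (λ x → Q? x ×-dec R? x y) ] g ≡ 0ℤ) →
               ∑[ Q? ] g ≡ 0ℤ
    ∑-fibres R? R-total R-functional R-resp fibre≡0 = begin
      ∑[ Q? ] g                                     ≡⟨ Σ-cong expand ⟩
      Σ (λ x → Σ λ y → ⟦ Q? x ×-dec R? x y ⟧ (g x)) ≡⟨ sumℤ-swap _ elements elements ⟩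
      Σ (λ y → Σ λ x → ⟦ Q? x ×-dec R? x y ⟧ (g x)) ≡⟨ Σ-zero fibre≡0 ⟩
      0ℤ                                            ∎
      where
      open ≡-Reasoning
      expand : ∀ x → ⟦ Q? x ⟧ (g x) ≡ Σ λ y → ⟦ Q? x ×-dec R? x y ⟧ (g x)
      expand x with Q? x
      ... | no  _  = sym (Σ-zero λ _ → refl)
      ... | yes Qx = let (y , Rxy) = R-total Qx in sym (Σ-single
        (λ z y≈z → ⟦⟧-yes (yes Qx ×-dec R? x z) (Qx , R-resp y≈z Rxy) (g x))
        (λ z y≉z → ⟦⟧-zero (yes Qx ×-dec R? x z)
                     λ (_ , Rxz) → contradiction (R-functional Qx Rxy Rxz) y≉z))

-- The Möbius function from the minimum, and Weisner's theorem.

module MöbiusFromMinimum {c ℓ₁ ℓ₂} (P : FinitePoset c ℓ₁ ℓ₂)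
  (0# : FinitePoset.Carrier P) (0#-minimum : Minimum (FinitePoset._≤_ P) 0#) where

  open FinitePoset P renaming (refl to ≤-refl; trans to ≤-trans)
  open Möbius P using (μ; μ-diagonal; μ-recursion; _∈[_,_⟩; _∈[_,_⟩?; <-wf)
  open Summation P

  μ₀ : Carrier → ℤ
  μ₀ = μ 0#

  μ₀-recursion : ∀ {y} → ¬ 0# ≈ y → μ₀ y ≡ - ∑[ _∈[ 0# , y ⟩? ] μ₀
  μ₀-recursion {y} 0≉y =
    trans (μ-recursion 0≉y) (cong -_ (sumℤ-filter (_∈[ 0# , y ⟩?) μ₀ elements))

  μ₀-cong : ∀ {x y} → x ≈ y → μ₀ x ≡ μ₀ y
  μ₀-cong {x} {y} x≈y = case 0# ≟ x of λ where
      (yes 0≈x) → trans (μ-diagonal 0≈x) (sym (μ-diagonal (Eq.trans 0≈x x≈y)))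
      (no  0≉x) → begin
        μ₀ x                     ≡⟨ μ₀-recursion 0≉x ⟩
        - ∑[ _∈[ 0# , x ⟩? ] μ₀  ≡⟨ cong -_ (∑-⇔ (_∈[ 0# , x ⟩?) μ₀ (_∈[ 0# , y ⟩?)
                                               (mono x≈y) (mono (Eq.sym x≈y))) ⟩
        - ∑[ _∈[ 0# , y ⟩? ] μ₀  ≡⟨ μ₀-recursion (λ 0≈y → 0≉x (Eq.trans 0≈y (Eq.sym x≈y))) ⟨
        μ₀ y                     ∎
    where
    open ≡-Reasoning
    mono : ∀ {u v z} → u ≈ v → z ∈[ 0# , u ⟩ → z ∈[ 0# , v ⟩
    mono u≈v (0≤z , z≤u , z≉u) =
      0≤z , ≤-trans z≤u (reflexive u≈v) , λ z≈v → z≉u (Eq.trans z≈v (Eq.sym u≈v))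

  -- The recursion for `μ₀ y` with all terms moved to one side.
  ∑-below : ∀ {y} → ¬ 0# ≈ y → ∑[ _≤? y ] μ₀ ≡ 0ℤ
  ∑-below {y} 0≉y = begin
    ∑[ _≤? y ] μ₀
      ≡⟨ ∑-split (_≤? y) μ₀ (_≟ y) ⟩
    ∑[ (λ x → (x ≤? y) ×-dec (x ≟ y)) ] μ₀ + ∑[ (λ x → (x ≤? y) ×-dec ¬? (x ≟ y)) ] μ₀
      ≡⟨ cong₂ _+_
           (∑-single _ μ₀ μ₀-cong (λ y≈x → reflexive (Eq.sym y≈x) , Eq.sym y≈x)
             (λ x (_ , x≈y) y≉x → contradiction (Eq.sym x≈y) y≉x))
           (∑-⇔ _ μ₀ (_∈[ 0# , y ⟩?) (λ x<y → 0#-minimum _ , x<y) proj₂) ⟩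
    μ₀ y + ∑[ _∈[ 0# , y ⟩? ] μ₀
      ≡⟨ cong (_+ ∑[ _∈[ 0# , y ⟩? ] μ₀) (μ₀-recursion 0≉y) ⟩
    - ∑[ _∈[ 0# , y ⟩? ] μ₀ + ∑[ _∈[ 0# , y ⟩? ] μ₀
      ≡⟨ ℤ.+-inverseˡ (∑[ _∈[ 0# , y ⟩? ] μ₀) ⟩
    0ℤ ∎
    where open ≡-Reasoning

  -- Weisner's theorem, for an element a whose join with every x ≤ u exists;
  -- J x y says that y is the join of x and a.
  module Weisner {a : Carrier} (a≰0 : ¬ a ≤ 0#)
    {J : Rel Carrier r} (J? : Decidable J)
    (J-upperˡ : ∀ {x y} → J x y → x ≤ y)
    (J-upperʳ : ∀ {x y} → J x y → a ≤ y)
    (J-least  : ∀ {x y z} → J x y → x ≤ z → a ≤ z → y ≤ z)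
    (J-resp   : ∀ {x} → J x Respects _≈_) where

    J-functional : ∀ {x y z} → J x y → J x z → y ≈ z
    J-functional Jxy Jxz = antisym (J-least Jxy (J-upperˡ Jxz) (J-upperʳ Jxz))
                                   (J-least Jxz (J-upperˡ Jxy) (J-upperʳ Jxy))

    -- Group the `x ≤ u` by their join `y` with `a`. If `a ≤ u`, every `y` is at most `u`; the whole
    -- sum vanishes by `∑-below` and the groups with `y < u` vanish by induction, which leaves the
    -- group of `u`. If `a ≰ u`, no join equals `u`.
    weisner-acc : ∀ {u} → Acc _<_ u → (∀ {x} → x ≤ u → ∃ (J x)) →
                  ∑[ (λ x → J? x u) ] μ₀ ≡ 0ℤ
    weisner-acc {u} (acc rec) joins with a ≤? u
    ... | no  a≰u = ∑-zero (λ x → J? x u) μ₀ λ _ Jxu → contradiction (J-upperʳ Jxu) a≰u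
    ... | yes a≤u = begin
      ∑[ (λ x → J? x u) ] μ₀
        ≡⟨ ∑-⇔ (λ x → J? x u) μ₀ (λ x → (x ≤? u) ×-dec J? x u)
             (λ Jxu → J-upperˡ Jxu , Jxu) proj₂ ⟩
      ∑[ (λ x → (x ≤? u) ×-dec J? x u) ] μ₀
        ≡⟨ ℤ.+-identityʳ _ ⟨
      ∑[ (λ x → (x ≤? u) ×-dec J? x u) ] μ₀ + 0ℤ
        ≡⟨ cong (∑[ (λ x → (x ≤? u) ×-dec J? x u) ] μ₀ +_)
             (∑-fibres (λ x → (x ≤? u) ×-dec ¬? (J? x u)) μ₀ J?
               (joins ∘ proj₁) (λ _ → J-functional) J-resp fibre≡0) ⟨
      ∑[ (λ x → (x ≤? u) ×-dec J? x u) ] μ₀ + ∑[ (λ x → (x ≤? u) ×-dec ¬? (J? x u)) ] μ₀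
        ≡⟨ ∑-split (_≤? u) μ₀ (λ x → J? x u) ⟨
      ∑[ _≤? u ] μ₀
        ≡⟨ ∑-below (λ 0≈u → a≰0 (≤-trans a≤u (reflexive (Eq.sym 0≈u)))) ⟩
      0ℤ ∎
      where
      open ≡-Reasoning
      fibre≡0 : ∀ y → ∑[ (λ x → ((x ≤? u) ×-dec ¬? (J? x u)) ×-dec J? x y) ] μ₀ ≡ 0ℤ
      fibre≡0 y with y <? u
      ... | yes (y≤u , y≉u) = trans
        (∑-⇔ _ μ₀ (λ x → J? x y) proj₂ (λ Jxy →
           (≤-trans (J-upperˡ Jxy) y≤u , λ Jxu → y≉u (J-functional Jxy Jxu)) , Jxy))
        (weisner-acc (rec (y≤u , y≉u)) (λ x≤y → joins (≤-trans x≤y y≤u)))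
      ... | no y≮u = ∑-zero _ μ₀ λ x ((x≤u , ¬Jxu) , Jxy) →
        contradiction (J-least Jxy x≤u a≤u , λ y≈u → ¬Jxu (J-resp y≈u Jxy)) y≮u

    weisner : ∀ {u} → (∀ {x} → x ≤ u → ∃ (J x)) → ∑[ (λ x → J? x u) ] μ₀ ≡ 0ℤ
    weisner = weisner-acc (<-wf _)

-- Bipartitional relations and their joins with cuts.

module _ {X : Set a} where

  -- The contrapositive of transitivity of the complement, turned into a disjunction by
  -- decidability.
  cotransitive : (V : Bip X) → ∀ {x z} → rel V x z → ∀ y → rel V x y ⊎ rel V y z
  cotransitive V {x} {z} xz y with rel? V x y | rel? V y z
  ... | yes xy | _      = inj₁ xy
  ... | no _   | yes yz = inj₂ yz
  ... | no ¬xy | no ¬yz = contradiction xz (proj₂ (bipartitional V) ¬xy ¬yz)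

  transitive : (V : Bip X) → ∀ {x y z} → rel V x y → rel V y z → rel V x z
  transitive V = proj₁ (bipartitional V)

  Cut : U.Pred X b → Rel X b
  Cut C x y = C x × ¬ C y

  -- For decidable `C` this says that `V` is disjoint from Cᶜ × C.
  DownClosed : Bip X → U.Pred X b → Set _
  DownClosed V C = ∀ {x y} → rel V x y → C y → C x

  module _ {C : U.Pred X 0ℓ} (C? : U.Decidable C) where

    -- A pair of `V` ending in `C` also starts in `C`, so composing a pair of `V` with a pair of the
    -- cut, in either order, gives a pair of the cut. Hence the union is transitive and is the join.
    adjoin : (V : Bip X) → DownClosed V C → Bip X
    adjoin V down = record
      { rel           = λ x y → rel V x y ⊎ Cut C x y
      ; rel?          = λ x y → rel? V x y ⊎-dec (C? x ×-dec ¬? (C? y))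
      ; bipartitional = adjoin-trans , adjoin-cotrans
      }
      where
      adjoin-trans : ∀ {x y z} → rel V x y ⊎ Cut C x y → rel V y z ⊎ Cut C y z →
                     rel V x z ⊎ Cut C x z
      adjoin-trans (inj₁ xy)         (inj₁ yz)         = inj₁ (transitive V xy yz)
      adjoin-trans (inj₁ xy)         (inj₂ (Cy , ¬Cz)) = inj₂ (down xy Cy , ¬Cz)
      adjoin-trans (inj₂ (Cx , ¬Cy)) (inj₁ yz)         = inj₂ (Cx , ¬Cy ∘ down yz)
      adjoin-trans (inj₂ (_ , ¬Cy))  (inj₂ (Cy , _))   = contradiction Cy ¬Cy

      adjoin-cotrans : ∀ {x y z} → ¬ (rel V x y ⊎ Cut C x y) → ¬ (rel V y z ⊎ Cut C y z) →
                       ¬ (rel V x z ⊎ Cut C x z)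
      adjoin-cotrans ¬xy ¬yz (inj₁ xz) =
        proj₂ (bipartitional V) (¬xy ∘ inj₁) (¬yz ∘ inj₁) xz
      adjoin-cotrans {y = y} ¬xy ¬yz (inj₂ (Cx , ¬Cz)) with C? y
      ... | yes Cy = ¬yz (inj₂ (Cy , ¬Cz))
      ... | no ¬Cy = ¬xy (inj₂ (Cx , ¬Cy))

    cut : Bip X
    cut = adjoin ∅ λ ()

  -- W = V ∪ (C × Cᶜ) as a relation between `V` and `W`: the union is not bipartitional for every
  -- `V`, and it matters only up to mutual inclusion.
  Join : U.Pred X b → Rel (Bip X) _
  Join C V W = V ⊆ W × (Cut C ⇒ rel W) × (∀ {x y} → rel W x y → rel V x y ⊎ Cut C x y)

  Join-cong : {C : U.Pred X b} {D : U.Pred X q} → C U.⊆ D → D U.⊆ C →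
              ∀ {V W W′} → W ⊆ W′ → W′ ⊆ W → Join C V W → Join D V W′
  Join-cong C⊆D D⊆C W⊆W′ W′⊆W (V⊆W , C⊆W , W⊆V∪C) =
    W⊆W′ ∘ V⊆W ,
    (λ (Dx , ¬Dy) → W⊆W′ (C⊆W (D⊆C Dx , ¬Dy ∘ C⊆D))) ,
    λ xy → case W⊆V∪C (W′⊆W xy) of λ where
      (inj₁ Vxy)         → inj₁ Vxy
      (inj₂ (Cx , ¬Cy)) → inj₂ (C⊆D Cx , ¬Cy ∘ D⊆C)

  Irreflexive : Bip X → Set _
  Irreflexive V = ∀ {x} → ¬ rel V x x

-- Weisner's theorem for cuts, and vanishing of the Möbius function at relations with a loop.

module BipMöbius {X : Set a} {n : ℕ} (X↔Fin : X ↔ Fin n) where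

  open Inverse X↔Fin using (to; from; strictlyInverseˡ)
  open FinitePoset (bipFinitePoset X↔Fin) using (_≈_; _≟_; _≤?_; _<_)
  open Möbius (bipFinitePoset X↔Fin) using (<-wf; μ-diagonal)
  open Summation (bipFinitePoset X↔Fin)
  open MöbiusFromMinimum (bipFinitePoset X↔Fin) ∅ ∅-minimum

  ∀? : {P : U.Pred X b} → U.Decidable P → Dec (∀ {x} → P x)
  ∀? = all? X↔Fin

  irreflexive? : U.Decidable (Irreflexive {X = X})
  irreflexive? V = ∀? λ x → ¬? (rel? V x x)

  module _ {C : U.Pred X 0ℓ} (C? : U.Decidable C) where

    Join? : Decidable (Join C)
    Join? V W = (V ≤? W)
      ×-dec ∀? (λ x → ∀? λ y → (C? x ×-dec ¬? (C? y)) →-dec rel? W x y)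
      ×-dec ∀? (λ x → ∀? λ y → rel? W x y →-dec (rel? V x y ⊎-dec (C? x ×-dec ¬? (C? y))))

    -- Every `V ⊆ W` inherits down-closedness of `C` from `W`, so `adjoin` supplies the joins that
    -- Weisner's theorem asks for.
    ∑-Join : ¬ cut C? ⊆ ∅ → ∀ {W} → DownClosed W C → ∑[ (λ V → Join? V W) ] μ₀ ≡ 0ℤ
    ∑-Join C≰∅ {W} down = weisner {W} λ {V} V⊆W →
        adjoin C? V (λ xy → down (V⊆W xy)) , inj₁ , inj₂ , id
      where
      upperʳ : ∀ {V W} → Join C V W → cut C? ⊆ W
      upperʳ (_ , C⊆W , _) (inj₂ c) = C⊆W c

      least : ∀ {V W Z} → Join C V W → V ⊆ Z → cut C? ⊆ Z → W ⊆ Z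
      least (_ , _ , W⊆V∪C) V⊆Z C⊆Z xy = case W⊆V∪C xy of λ where
        (inj₁ v) → V⊆Z v
        (inj₂ c) → C⊆Z (inj₂ c)

      resp : ∀ {V} → Join C V Respects _≈_
      resp {V} {W} {W′} (W⊆W′ ⇔, W′⊆W) = Join-cong id id {V} {W} {W′} W⊆W′ W′⊆W

      open Weisner {a = cut C?} C≰∅ Join? proj₁
        (λ {V} {W} → upperʳ {V} {W}) (λ {V} {W} {Z} → least {V} {W} {Z})
        (λ {V} {W} {W′} → resp {V} {W} {W′})

  -- A cut has no loops, so every `W` whose join with it is `V` still has the loop at `x`. Induction
  -- removes each such `W` other than `V` from Weisner's sum.
  μ-nonirreflexive-acc : ∀ {V} → Acc _<_ V → ¬ X×X X ⊆ V → ∀ {x} → rel V x x → μ₀ V ≡ 0ℤ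
  μ-nonirreflexive-acc {V} (acc rec) V≢X×X {x} xx =
    cases (∀? λ y → rel? V x y) (∀? λ y → rel? V y x)
    where
    via-cut : {C : U.Pred X 0ℓ} (C? : U.Decidable C) → ¬ cut C? ⊆ ∅ →
              Cut C ⇒ rel V → DownClosed V C → μ₀ V ≡ 0ℤ
    via-cut {C} C? C≰∅ C⊆V down = trans
      (sym (∑-single (λ W → Join? C? W V) μ₀ μ₀-cong
        (λ (V⊆W ⇔, W⊆V) → W⊆V , C⊆V , inj₁ ∘ V⊆W)
        λ W (W⊆V , _ , V⊆W∪C) V≉W → μ-nonirreflexive-acc {W}
          (rec (W⊆V , λ (_ ⇔, V⊆W) → V≉W (V⊆W ⇔, W⊆V)))
          (λ ⊤⊆W → V≢X×X (W⊆V ∘ ⊤⊆W))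
          (case V⊆W∪C xx of λ where
            (inj₁ Wxx)        → Wxx
            (inj₂ (Cx , ¬Cx)) → contradiction Cx ¬Cx)))
      (∑-Join C? C≰∅ {V} down)

    cases : Dec (∀ {y} → rel V x y) → Dec (∀ {y} → rel V y x) → μ₀ V ≡ 0ℤ
    -- `C` consists of the points not above `x`. It is nonempty by `¬∀xy`, and the loop puts `x`
    -- outside it.
    cases (no ¬∀xy) _ = via-cut (λ y → ¬? (rel? V x y))
      (λ empty → ¬∀xy λ {y} → decidable-stable (rel? V x y) λ ¬xy →
         empty {y} {x} (inj₂ (¬xy , λ ¬xx → ¬xx xx)))
      (λ {y} {z} (¬xy , ¬¬xz) → case cotransitive V (decidable-stable (rel? V x z) ¬¬xz) y of λ where
         (inj₁ xy) → contradiction xy ¬xy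
         (inj₂ yz) → yz)
      (λ yz ¬xz xy → ¬xz (transitive V xy yz))
    -- Dually, `C` consists of the points below `x`, among them `x` itself.
    cases (yes _) (no ¬∀yx) = via-cut (λ y → rel? V y x)
      (λ empty → ¬∀yx λ {y} → decidable-stable (rel? V y x) λ ¬yx →
         empty {x} {y} (inj₂ (xx , ¬yx)))
      (λ {y} {z} (yx , ¬zx) → case cotransitive V yx z of λ where
         (inj₁ yz) → yz
         (inj₂ zx) → contradiction zx ¬zx)
      (λ yz zx → transitive V yz zx)
    cases (yes ∀xy) (yes ∀yx) = ⊥-elim (V≢X×X λ _ → transitive V ∀yx ∀xy)

  μ-nonirreflexive : ∀ {V} → ¬ X×X X ⊆ V → ¬ Irreflexive V → μ₀ V ≡ 0ℤ
  μ-nonirreflexive {V} V≢X×X ¬irr = decidable-stable (μ₀ V ℤ.≟ 0ℤ) λ μ≢0 →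
    ¬irr λ xx → μ≢0 (μ-nonirreflexive-acc {V} (<-wf V) V≢X×X xx)

  -- In the vanishing sum over all of Bip(X), the only contribution that is not irreflexive is that
  -- of `X×X X`. The given point makes `X×X X` differ from `∅` and have a loop.
  ∑-irreflexive : X → ∑[ irreflexive? ] μ₀ + μ₀ (X×X X) ≡ 0ℤ
  ∑-irreflexive x = begin
    ∑[ irreflexive? ] μ₀ + μ₀ (X×X X)
      ≡⟨ cong₂ _+_
           (∑-⇔ irreflexive? μ₀ (λ V → (V ≤? X×X X) ×-dec irreflexive? V)
             (λ {V} irr → X×X-maximum V , λ {y} → irr {y}) proj₂)
           (sym (∑-single (λ V → (V ≤? X×X X) ×-dec ¬? (irreflexive? V)) μ₀ μ₀-cong
             (λ {V} (⊤⊆V ⇔, _) → X×X-maximum V , λ irr → irr {x} (⊤⊆V _))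
             (λ V (_ , ¬irr) ⊤≉V → μ-nonirreflexive (λ ⊤⊆V → ⊤≉V (⊤⊆V ⇔, X×X-maximum V)) ¬irr))) ⟩
    ∑[ (λ V → (V ≤? X×X X) ×-dec irreflexive? V) ] μ₀ +
    ∑[ (λ V → (V ≤? X×X X) ×-dec ¬? (irreflexive? V)) ] μ₀
      ≡⟨ ∑-split (_≤? X×X X) μ₀ irreflexive? ⟨
    ∑[ _≤? X×X X ] μ₀
      ≡⟨ ∑-below {X×X X} (λ (_ ⇔, ⊤⊆∅) → ⊤⊆∅ {x} {x} _) ⟩
    0ℤ ∎
    where open ≡-Reasoning

  -- The chain of relations `initial i` and its Möbius values.

  ι : X → ℕ
  ι = toℕ ∘ to

  ι-injective : ∀ {x y} → ι x ≡ ι y → x ≡ y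
  ι-injective = Injection.injective (↔⇒↣ X↔Fin) ∘ Fin.toℕ-injective

  point : ∀ {i} → i ℕ.< n → X
  point i<n = from (fromℕ< i<n)

  ι-point : ∀ {i} (i<n : i ℕ.< n) → ι (point i<n) ≡ i
  ι-point i<n = trans (cong toℕ (strictlyInverseˡ _)) (Fin.toℕ-fromℕ< i<n)

  -- The bipartitional relation with the non-underlined blocks
  -- {0}, {1}, …, {i-1} and {i, …, n-1}, in this order.
  initial : ℕ → Bip X
  initial i = record
    { rel           = λ x y → ι x ℕ.< i × ι x ℕ.< ι y
    ; rel?          = λ x y → (ι x ℕ.<? i) ×-dec (ι x ℕ.<? ι y)
    ; bipartitional =
        (λ (x<i , x<y) (_ , y<z) → x<i , ℕ.<-trans x<y y<z) ,
        (λ {x} {y} ¬xy ¬yz (x<i , x<z) →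
          let y≤x = ℕ.≮⇒≥ (λ x<y → ¬xy (x<i , x<y))
          in ¬yz (ℕ.≤-<-trans y≤x x<i , ℕ.≤-<-trans y≤x x<z))
    }

  initial-mono : ∀ {i} → initial i ⊆ initial (suc i)
  initial-mono (x<i , x<y) = ℕ.m<n⇒m<1+n x<i , x<y

  -- Only the row of the point i distinguishes initial (suc i) from initial i.
  initial-suc-⊆ : ∀ {i} (i<n : i ℕ.< n) {V : Bip X} → initial i ⊆ V →
                  (∀ {y} → i ℕ.< ι y → rel V (point i<n) y) → initial (suc i) ⊆ V
  initial-suc-⊆ {i} i<n {V} L⊆V row {x} {y} (x<1+i , x<y) = case ℕ.m<1+n⇒m<n∨m≡n x<1+i of λ where
    (inj₁ x<i) → L⊆V (x<i , x<y)
    (inj₂ x≡i) → subst (λ z → rel V z y) (ι-injective (trans (ι-point i<n) (sym x≡i)))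
                   (row (subst (ℕ._< ι y) x≡i x<y))

  -- Outside the cut, `V` agrees with `initial (suc i)`. Cotransitivity then forces all rows before
  -- the point i into `V` and makes the row of that point all or nothing.
  initial-below-join : ∀ {i} → suc i ℕ.< n → ∀ {V} → Join (λ x → ι x ℕ.≤ i) V (initial (suc i)) →
                       ¬ initial (suc i) ≈ V → initial i ≈ V
  initial-below-join {i} 1+i<n {V} (V⊆L , _ , L⊆V∪C) L≉V = L⊆V ⇔, V⊆L′
    where
    i<n = ℕ.<-trans (ℕ.n<1+n i) 1+i<n

    p = point i<n

    L⊆V : initial i ⊆ V
    L⊆V {x} {y} (x<i , x<y) = case L⊆V∪C (ℕ.m<n⇒m<1+n x<i , x<y) of λ where
      (inj₁ xy) → xy
      (inj₂ (_ , y≰i)) →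
        -- For `y` beyond the cut, go through `p`: the pair from `x` to `p` stays on the lower side,
        -- hence lies in `V`, while `V` has no pair from `y` to `p`.
        let x<p = subst (ι x ℕ.<_) (sym (ι-point i<n)) x<i
            xp = case L⊆V∪C {x} {p} (ℕ.m<n⇒m<1+n x<i , x<p) of λ where
                   (inj₁ xp)        → xp
                   (inj₂ (_ , p≰i)) → contradiction (ℕ.≤-reflexive (ι-point i<n)) p≰i
        in case cotransitive V xp y of λ where
          (inj₁ xy) → xy
          (inj₂ yp) → contradiction (ℕ.≤-pred (proj₁ (V⊆L yp))) y≰i

    V⊆L′ : V ⊆ initial i
    V⊆L′ {x} {y} xy = let (x<1+i , x<y) = V⊆L xy in case ℕ.m<1+n⇒m<n∨m≡n x<1+i of λ where
      (inj₁ x<i) → x<i , x<y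
      -- Here `x` is `p`, and this one pair in `V` already forces the whole row of `p` into `V`.
      (inj₂ x≡i) → ⊥-elim (L≉V
        (initial-suc-⊆ i<n {V} L⊆V (λ {z} i<z →
           case cotransitive V xy z of λ where
             (inj₁ xz) → subst (λ w → rel V w z) (ι-injective (trans x≡i (sym (ι-point i<n)))) xz
             (inj₂ zy) → contradiction (proj₁ (V⊆L zy)) (ℕ.≤⇒≯ i<z))
          ⇔, V⊆L))

  -- Weisner's theorem for the cut after the point i: only `initial i` and `initial (suc i)` have
  -- join `initial (suc i)` with it, so their values cancel.
  μ-initial : ∀ i → i ℕ.< n → μ₀ (initial i) ≡ -1ℤ ^ i
  μ-initial zero    _     = μ-diagonal ((λ ()) ⇔, λ ())
  μ-initial (suc i) 1+i<n = begin
    μ₀ (initial (suc i))   ≡⟨ inverseʳ-unique ℤ.+-0-abelianGroup _ _ sum≡0 ⟩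
    - μ₀ (initial i)       ≡⟨ cong -_ (μ-initial i i<n) ⟩
    - (-1ℤ ^ i)            ≡⟨ ℤ.-1*i≡-i (-1ℤ ^ i) ⟨
    -1ℤ ^ suc i            ∎
    where
    open ≡-Reasoning
    i<n = ℕ.<-trans (ℕ.n<1+n i) 1+i<n

    C? : U.Decidable (λ x → ι x ℕ.≤ i)
    C? x = ι x ℕ.≤? i

    p≤i : ι (point i<n) ℕ.≤ i
    p≤i = ℕ.≤-reflexive (ι-point i<n)

    -- The bound `1+i<n` supplies a point beyond the cut. So the cut is nonempty, and `initial i`
    -- differs from `initial (suc i)`.
    q≰i : ¬ ι (point 1+i<n) ℕ.≤ i
    q≰i = ℕ.<⇒≱ (ℕ.≤-reflexive (sym (ι-point 1+i<n)))

    split : ∀ {x y} → rel (initial (suc i)) x y → rel (initial i) x y ⊎ Cut (λ x → ι x ℕ.≤ i) x y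
    split {x} {y} (x<1+i , x<y) with ι y ℕ.≤? i
    ... | yes y≤i = inj₁ (ℕ.<-≤-trans x<y y≤i , x<y)
    ... | no  y≰i = inj₂ (ℕ.≤-pred x<1+i , y≰i)

    cut⊆ : Cut (λ x → ι x ℕ.≤ i) ⇒ rel (initial (suc i))
    cut⊆ (x≤i , y≰i) = s≤s x≤i , ℕ.≤-<-trans x≤i (ℕ.≰⇒> y≰i)

    L = initial (suc i)

    L≉L′ : ∀ {V} → initial i ≈ V → ¬ V ≈ L
    L≉L′ (_ ⇔, V⊆L′) (_ ⇔, L⊆V) =
      ℕ.<-irrefl (ι-point i<n) (proj₁ (V⊆L′ (L⊆V (cut⊆ {point i<n} {point 1+i<n} (p≤i , q≰i)))))

    sum≡0 : μ₀ (initial i) + μ₀ L ≡ 0ℤ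
    sum≡0 = begin
      μ₀ (initial i) + μ₀ L
        ≡⟨ ℤ.+-comm (μ₀ (initial i)) _ ⟩
      μ₀ L + μ₀ (initial i)
        ≡⟨ cong₂ _+_
             (∑-single (λ V → Join? C? V L ×-dec (V ≟ L)) μ₀ μ₀-cong
               (λ (L⊆V ⇔, V⊆L) → (V⊆L , cut⊆ , inj₁ ∘ L⊆V) , (V⊆L ⇔, L⊆V))
               (λ V (_ , (V⊆L ⇔, L⊆V)) L≉V → ⊥-elim (L≉V (L⊆V ⇔, V⊆L))))
             (∑-single (λ V → Join? C? V L ×-dec ¬? (V ≟ L)) μ₀ μ₀-cong
               (λ {V} (L′⊆V ⇔, V⊆L′) →
                 (initial-mono ∘ V⊆L′ , cut⊆ , λ xy → Sum.map₁ L′⊆V (split xy)) ,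
                 L≉L′ {V} (L′⊆V ⇔, V⊆L′))
               (λ V (J , V≉L) L′≉V → ⊥-elim (L′≉V
                 (initial-below-join 1+i<n {V} J λ (L⊆V ⇔, V⊆L) → V≉L (V⊆L ⇔, L⊆V))))) ⟨
      ∑[ (λ V → Join? C? V L ×-dec (V ≟ L)) ] μ₀ + ∑[ (λ V → Join? C? V L ×-dec ¬? (V ≟ L)) ] μ₀
        ≡⟨ ∑-split (λ V → Join? C? V L) μ₀ (_≟ L) ⟨
      ∑[ (λ V → Join? C? V L) ] μ₀
        ≡⟨ ∑-Join C? (λ C⊆∅ → C⊆∅ (inj₂ (p≤i , q≰i))) {L}
             (λ (_ , x<y) y≤i → ℕ.≤-trans (ℕ.<⇒≤ x<y) y≤i) ⟩
      0ℤ ∎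

  -- Reduction of the sum over irreflexive relations along the chain.

  Σ≥initial : ℕ → ℤ
  Σ≥initial i = ∑[ (λ V → irreflexive? V ×-dec (initial i ≤? V)) ] μ₀

  module Step {i : ℕ} (i<n : i ℕ.< n) where

    p : X
    p = point i<n

    -- `p` is kept out of this set so that the cut it defines contains no pair starting at `p`;
    -- adjoining the cut leaves the row of `p` unchanged.
    NotAbove : Bip X → U.Pred X 0ℓ
    NotAbove V y = ι y ≢ i × ¬ rel V p y

    NotAbove? : ∀ V → U.Decidable (NotAbove V)
    NotAbove? V y = ¬? (ι y ℕ.≟ i) ×-dec ¬? (rel? V p y)

    p∉NotAbove : ∀ V → ¬ NotAbove V p
    p∉NotAbove V (p≢i , _) = p≢i (ι-point i<n)

    NotAbove-downClosed : ∀ {V} → Irreflexive V → DownClosed V (NotAbove V)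
    NotAbove-downClosed {V} irr {x} {y} xy (y≢i , ¬py) =
      (λ x≡i → ¬py (subst (λ z → rel V z y) (ι-injective (trans x≡i (sym (ι-point i<n)))) xy)) ,
      (λ px → ¬py (transitive V px xy))

    Q : U.Pred (Bip X) a
    Q V = (Irreflexive V × initial i ⊆ V) × ¬ initial (suc i) ⊆ V

    Q? : U.Decidable Q
    Q? V = (irreflexive? V ×-dec (initial i ≤? V)) ×-dec ¬? (initial (suc i) ≤? V)

    -- The cut is read off `W` instead of `V`, so that all `V` in the fibre over `W` share one fixed
    -- cut and `∑-Join` applies. Both readings agree because `V` and `W` have the same row of `p`.
    Splits : Rel (Bip X) a
    Splits V W = Join (NotAbove W) V W

    row : ∀ {V W} → Splits V W → ∀ {y} → rel W p y → rel V p y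
    row {W = W} (_ , _ , W⊆V∪C) py = case W⊆V∪C py of λ where
      (inj₁ Vpy)      → Vpy
      (inj₂ (Cp , _)) → contradiction Cp (p∉NotAbove W)

    NotAbove-antitone : ∀ {V W} → (∀ {y} → rel V p y → rel W p y) → NotAbove W U.⊆ NotAbove V
    NotAbove-antitone V⊆W (y≢i , ¬py) = y≢i , ¬py ∘ V⊆W

    -- `W` and `W′` both have the row of `p` in `V`, hence they define the same cut.
    Splits-functional : ∀ {V W W′} → Splits V W → Splits V W′ → W ⊆ W′
    Splits-functional {V} {W} {W′} S@(V⊆W , _ , W⊆V∪C) S′@(V⊆W′ , C⊆W′ , _) xy =
      case W⊆V∪C xy of λ where
        (inj₁ Vxy)        → V⊆W′ Vxy
        (inj₂ (Cx , ¬Cy)) → C⊆W′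
          ( NotAbove-antitone {W′} {W} (V⊆W ∘ row {V} {W′} S′) Cx
          , ¬Cy ∘ NotAbove-antitone {W} {W′} (V⊆W′ ∘ row {V} {W} S))

    Splits-total : ∀ {V} → Q V → ∃ (Splits V)
    Splits-total {V} ((irr , _) , _) =
      W , Join-cong (NotAbove-antitone {W} {V} W⊆V) (NotAbove-antitone {V} {W} inj₁)
            {V} {W} {W} id id (inj₁ , inj₂ , id)
      where
      W = adjoin (NotAbove? V) V (NotAbove-downClosed {V} irr)

      W⊆V : ∀ {y} → rel W p y → rel V p y
      W⊆V (inj₁ py)       = py
      W⊆V (inj₂ (Cp , _)) = contradiction Cp (p∉NotAbove V)

    Splits-resp : ∀ {V} → Splits V Respects _≈_
    Splits-resp {V} {W} {W′} (W⊆W′ ⇔, W′⊆W) =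
      Join-cong (NotAbove-antitone {W′} {W} W′⊆W) (NotAbove-antitone {W} {W′} W⊆W′)
        {V} {W} {W′} W⊆W′ W′⊆W

    Splits-Q⁺ : ∀ {V W} → Splits V W → Q V → Q W
    Splits-Q⁺ {V} {W} S@(V⊆W , _ , W⊆V∪C) ((irr , L⊆V) , L′⊈V) =
      ((λ xx → case W⊆V∪C xx of λ where
          (inj₁ Vxx)        → irr Vxx
          (inj₂ (Cx , ¬Cx)) → ¬Cx Cx) ,
       V⊆W ∘ L⊆V) ,
      λ L′⊆W → L′⊈V (initial-suc-⊆ i<n {V} L⊆V λ {y} i<y →
        row {V} {W} S (L′⊆W (s≤s (ℕ.≤-reflexive (ι-point i<n)) , subst (ℕ._< ι y) (sym (ι-point i<n)) i<y)))

    Splits-Q⁻ : ∀ {V W} → Splits V W → Q W → Q V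
    Splits-Q⁻ {V} {W} (V⊆W , _ , W⊆V∪C) ((irr , L⊆W) , L′⊈W) =
      (irr ∘ V⊆W , L⊆V) , λ L′⊆V → L′⊈W (V⊆W ∘ L′⊆V)
      where
      L⊆V : initial i ⊆ V
      L⊆V {x} {y} (x<i , x<y) = case W⊆V∪C (L⊆W (x<i , x<y)) of λ where
        (inj₁ xy)        → xy
        (inj₂ (Cx , ¬Cy)) → decidable-stable (rel? V x y) λ ¬xy →
          -- As `W` misses part of the row of `p`, some `z` with index above i lies in `C`. The pair
          -- from `x` to `z` then avoids the cut and lies in `V`; cotransitivity at `y` would put
          -- `y` in `C`.
          L′⊈W (initial-suc-⊆ i<n {W} L⊆W λ {z} i<z → decidable-stable (rel? W p z) λ ¬pz →
            let Cz = (λ z≡i → ℕ.<-irrefl (sym z≡i) i<z) , ¬pz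
            in case W⊆V∪C (L⊆W {x} {z} (x<i , ℕ.<-trans x<i i<z)) of λ where
              (inj₂ (_ , ¬Cz)) → ¬Cz Cz
              (inj₁ xz) → case cotransitive V xz y of λ where
                (inj₁ xy) → ¬xy xy
                (inj₂ yz) → ¬Cy (NotAbove-downClosed {W} irr (V⊆W yz) Cz))

    -- Since `p` lies outside the set, an empty cut would mean that every point after `p` is above
    -- `p` in `W`, so `W` would contain `initial (suc i)`.
    NotAbove-nonempty : ∀ {W} → Q W → ¬ cut (NotAbove? W) ⊆ ∅
    NotAbove-nonempty {W} ((_ , L⊆W) , L′⊈W) C⊆∅ =
      L′⊈W (initial-suc-⊆ i<n {W} L⊆W λ {y} i<y → decidable-stable (rel? W p y) λ ¬py →
        C⊆∅ {y} {p} (inj₂ (((λ y≡i → ℕ.<-irrefl (sym y≡i) i<y) , ¬py) , p∉NotAbove W)))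

    -- For `W` in `Q`, all solutions `V` of `Splits V W` lie in `Q`, so the fibre is a full Weisner
    -- sum. For other `W` the fibre is empty.
    ∑-Q : ∑[ Q? ] μ₀ ≡ 0ℤ
    ∑-Q = ∑-fibres Q? μ₀ (λ V W → Join? (NotAbove? W) V W)
      (λ {V} → Splits-total {V})
      (λ {V} {W} {W′} _ S S′ →
        Splits-functional {V} {W} {W′} S S′ ⇔, Splits-functional {V} {W′} {W} S′ S)
      (λ {V} {W} {W′} → Splits-resp {V} {W} {W′}) fibre≡0
      where
      fibre≡0 : ∀ W → ∑[ (λ V → Q? V ×-dec Join? (NotAbove? W) V W) ] μ₀ ≡ 0ℤ
      fibre≡0 W = case Q? W of λ where
        (no ¬QW) → ∑-zero (λ V → Q? V ×-dec Join? (NotAbove? W) V W) μ₀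
                     λ V (QV , S) → contradiction (Splits-Q⁺ {V} {W} S QV) ¬QW
        (yes QW) → trans
          (∑-⇔ (λ V → Q? V ×-dec Join? (NotAbove? W) V W) μ₀ (λ V → Join? (NotAbove? W) V W)
             proj₂ (λ {V} S → Splits-Q⁻ {V} {W} S QW , S))
          (∑-Join (NotAbove? W) (NotAbove-nonempty {W} QW) {W}
             (NotAbove-downClosed {W} (proj₁ (proj₁ QW))))

    Σ≥initial-suc : Σ≥initial i ≡ Σ≥initial (suc i)
    Σ≥initial-suc = begin
      Σ≥initial i
        ≡⟨ ∑-split (λ V → irreflexive? V ×-dec (initial i ≤? V)) μ₀ (initial (suc i) ≤?_) ⟩
      ∑[ (λ V → (irreflexive? V ×-dec (initial i ≤? V)) ×-dec (initial (suc i) ≤? V)) ] μ₀ + ∑[ Q? ] μ₀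
        ≡⟨ cong₂ _+_
             (∑-⇔ _ μ₀ (λ V → irreflexive? V ×-dec (initial (suc i) ≤? V))
               (λ ((irr , _) , L′⊆V) → irr , L′⊆V)
               (λ (irr , L′⊆V) → (irr , L′⊆V ∘ initial-mono) , L′⊆V))
             ∑-Q ⟩
      Σ≥initial (suc i) + 0ℤ
        ≡⟨ ℤ.+-identityʳ _ ⟩
      Σ≥initial (suc i) ∎
      where open ≡-Reasoning

  ∑-irreflexive-initial : ∀ i → i ℕ.≤ n → ∑[ irreflexive? ] μ₀ ≡ Σ≥initial i
  ∑-irreflexive-initial zero    _   =
    ∑-⇔ irreflexive? μ₀ (λ V → irreflexive? V ×-dec (initial 0 ≤? V)) (λ irr → irr , λ ()) proj₁
  ∑-irreflexive-initial (suc i) i<n =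
    trans (∑-irreflexive-initial i (ℕ.<⇒≤ i<n)) (Step.Σ≥initial-suc i<n)

  -- The last block of `initial m` is a singleton, so `initial m` is the strict linear order given
  -- by `ι`; a pair in the opposite direction would create a loop.
  initial-maximal : ∀ {m} → n ≡ suc m → ∀ {V} → Irreflexive V → initial m ⊆ V → V ⊆ initial m
  initial-maximal {m} refl {V} irr L⊆V {x} {y} xy = case ℕ.<-cmp (ι x) (ι y) of λ where
    (tri< x<y _ _) → ℕ.<-≤-trans x<y (Fin.toℕ≤pred[n] (to y)) , x<y
    (tri≈ _ x≡y _) → contradiction (subst (rel V x) (sym (ι-injective x≡y)) xy) irr
    (tri> _ _ y<x) → contradiction
      (transitive V (L⊆V (ℕ.<-≤-trans y<x (Fin.toℕ≤pred[n] (to x)) , y<x)) xy) irr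

  Σ≥initial-maximal : ∀ {m} → n ≡ suc m → Σ≥initial m ≡ μ₀ (initial m)
  Σ≥initial-maximal {m} n≡1+m =
    ∑-single (λ V → irreflexive? V ×-dec (initial m ≤? V)) μ₀ μ₀-cong
      (λ (L⊆V ⇔, V⊆L) → (λ xx → ℕ.<-irrefl refl (proj₂ (V⊆L xx))) , L⊆V)
      (λ V (irr , L⊆V) L≉V → ⊥-elim (L≉V (L⊆V ⇔, initial-maximal n≡1+m {V} irr L⊆V)))

corollary9p5 : ∀ {a} {X : Set a} {n : ℕ} (X↔Fin : X ↔ Fin n) →
    Möbius.μ (bipFinitePoset X↔Fin) ∅ (X×X X) ≡ -1ℤ ^ n
-- For empty `X` the minimum and the maximum coincide.
corollary9p5 {X = X} {n = zero}  X↔Fin = Möbius.μ-diagonal (bipFinitePoset X↔Fin) {∅} {X×X X}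
  ((λ ()) ⇔, λ {x} _ → case Inverse.to X↔Fin x of λ ())
corollary9p5 {X = X} {n = suc m} X↔Fin = begin
  μ₀ (X×X X)              ≡⟨ inverseʳ-unique ℤ.+-0-abelianGroup (∑[ irreflexive? ] μ₀) (μ₀ (X×X X))
                               (∑-irreflexive (point ℕ.z<s)) ⟩
  - ∑[ irreflexive? ] μ₀  ≡⟨ cong -_ (∑-irreflexive-initial m (ℕ.n≤1+n m)) ⟩
  - Σ≥initial m           ≡⟨ cong -_ (Σ≥initial-maximal refl) ⟩
  - μ₀ (initial m)        ≡⟨ cong -_ (μ-initial m (ℕ.n<1+n m)) ⟩
  - (-1ℤ ^ m)             ≡⟨ ℤ.-1*i≡-i (-1ℤ ^ m) ⟨
  -1ℤ ^ suc m             ∎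
  where
  open ≡-Reasoning
  open BipMöbius X↔Fin
  open Summation (bipFinitePoset X↔Fin)
  open MöbiusFromMinimum (bipFinitePoset X↔Fin) ∅ ∅-minimum using (μ₀)
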